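{- Let $G$ be a finite group. Then $box(R(G))=box(Pow(G))$ and $cub(R(G))=cub(Pow(G))$.
   Context: All graphs are finite, simple and undirected. Boxicity and cubicity: a $k$-box (resp. $k$-cube) is a Cartesian product of $k$ closed intervals (resp. closed unit-length intervals) of $\mathbb{R}$. A $k$-box (resp. $k$-cube) representation of a graph $\Gamma$ is a function $f$ assigning to each vertex a $k$-box (resp. $k$-cube) such that two distinct vertices $u,v$ are adjacent if and only if $f(u)\cap f(v)\neq\emptyset$. The boxicity $box(\Gamma)$ (resp. cubicity $cub(\Gamma)$) is the smallest non-negative integer $k$ for which $\Gamma$ has a $k$-box (resp. $k$-cube) representation; complete graphs have boxicity and cubicity $0$. The power graph $Pow(G)$ of a group $G$ is the graph with vertex set $G$ in which two distinct vertices $x,y$ are adjacent if $x=y^m$ or $y=x^m$ for some positive integer $m$. Define an equivalence relation on $G$ by $x\sim y$ if and only if $\langle x\rangle=\langle y\rangle$, and write $[x]$ for the class of $x$. The reduced power graph $R(G)$ has as vertices the equivalence classes of $\sim$; two distinct classes $[x],[y]$ are adjacent if and only if $\{x,y\}$ is an edge of $Pow(G)$ (this does not depend on the choice of representatives). -}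

module Defs where

open import Level using (Level; 0ℓ; _⊔_) renaming (suc to lsuc)
open import Algebra.Bundles using (Group)
import Algebra.Properties.Group as GroupProperties
import Algebra.Properties.Monoid.Mult as MonoidMult
open import Data.Fin.Base as Fin using (Fin; toℕ)
import Data.Fin.Properties as Fin
open import Data.Integer.Base using (ℤ; +_; -[1+_])
open import Data.Nat.Base as ℕ using (ℕ; zero; suc; z≤n; s≤s)
import Data.Nat.Properties as ℕ
open import Data.Product.Base using (∃; _×_; _,_; proj₁; proj₂)
open import Data.Rational.Base as ℚ using (ℚ; 0ℚ; 1ℚ)
import Data.Rational.Properties as ℚ
open import Data.Sum.Base as Sum using (_⊎_; inj₁; inj₂)
open import Data.Vec.Functional using (Vector)
import Data.Vec.Functional.Relation.Binary.Equality.Setoid as VectorEquality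
open import Function.Base using (_∘_; id)
open import Function.Bundles
  using (Func; Inverse; LeftInverse; Surjection; _⇔_; mk⇔; Equivalence)
open import Relation.Binary.Bundles using (Setoid)
open import Relation.Binary.Core using (Rel)
open import Relation.Binary.Definitions using (Irreflexive; Symmetric; _Respects₂_)
open import Relation.Binary.PropositionalEquality as ≡ using (_≡_)
open import Relation.Nullary using (¬_; Dec; yes; no; contradiction)
open import Relation.Nullary.Decidable using (map′; ¬¬-excluded-middle)
open import Relation.Nullary.Negation using (¬¬-Monad)
open import Relation.Unary using (Pred; _∈_; _∉_; _≐_; _≬_)

private
  variable
    a c e ℓ v : Level

------------------------------------------------------------------------
-- Real numbers, as two-sided Dedekind cuts of ℚ

record ℝ : Set₁ where
  field
    L U         : Pred ℚ 0ℓ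
    L-inhabited : ∃ L
    U-inhabited : ∃ U
    L-rounded   : ∀ q → q ∈ L ⇔ (∃ λ r → q ℚ.< r × r ∈ L)
    U-rounded   : ∀ q → q ∈ U ⇔ (∃ λ r → r ℚ.< q × r ∈ U)
    disjoint    : ∀ q → q ∈ L → q ∉ U
    located     : ∀ {q r} → q ℚ.< r → q ∈ L ⊎ r ∈ U

open ℝ

infix 4 _≤_ _≃_

_≤_ : Rel ℝ 0ℓ
x ≤ y = ∀ q → q ∈ L x → q ∈ L y

_≃_ : Rel ℝ 0ℓ
x ≃ y = x ≤ y × y ≤ x

private
  -1+1 : ∀ q → (q ℚ.- 1ℚ) ℚ.+ 1ℚ ≡ q
  -1+1 q = ≡.trans (ℚ.+-assoc q _ 1ℚ)
             (≡.trans (≡.cong (q ℚ.+_) (ℚ.+-inverseˡ 1ℚ)) (ℚ.+-identityʳ q))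

  +1-1 : ∀ q → (q ℚ.+ 1ℚ) ℚ.- 1ℚ ≡ q
  +1-1 q = ≡.trans (ℚ.+-assoc q 1ℚ _)
             (≡.trans (≡.cong (q ℚ.+_) (ℚ.+-inverseʳ 1ℚ)) (ℚ.+-identityʳ q))

  -1-mono : ∀ {q r} → q ℚ.< r → q ℚ.- 1ℚ ℚ.< r ℚ.- 1ℚ
  -1-mono = ℚ.+-monoˡ-< (ℚ.- 1ℚ)

  -1<⇒<+1 : ∀ {q r} → q ℚ.- 1ℚ ℚ.< r → q ℚ.< r ℚ.+ 1ℚ
  -1<⇒<+1 {q} q-1<r = ≡.subst (ℚ._< _) (-1+1 q) (ℚ.+-monoˡ-< 1ℚ q-1<r)

  <-1⇒+1< : ∀ {q r} → r ℚ.< q ℚ.- 1ℚ → r ℚ.+ 1ℚ ℚ.< q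
  <-1⇒+1< {q} r<q-1 = ≡.subst (_ ℚ.<_) (-1+1 q) (ℚ.+-monoˡ-< 1ℚ r<q-1)

-- x + 1: a rational q lies below it exactly when q - 1 lies below x.
infixl 6 _+1

_+1 : ℝ → ℝ
x +1 = record
  { L           = λ q → q ℚ.- 1ℚ ∈ L x
  ; U           = λ q → q ℚ.- 1ℚ ∈ U x
  ; L-inhabited = let q , q∈L = L-inhabited x in
                  q ℚ.+ 1ℚ , ≡.subst (L x) (≡.sym (+1-1 q)) q∈L
  ; U-inhabited = let q , q∈U = U-inhabited x in
                  q ℚ.+ 1ℚ , ≡.subst (U x) (≡.sym (+1-1 q)) q∈U
  ; L-rounded   = λ q → mk⇔
      (λ q∈L → let r , q<r , r∈L = Equivalence.to (L-rounded x _) q∈L in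
               r ℚ.+ 1ℚ , -1<⇒<+1 q<r , ≡.subst (L x) (≡.sym (+1-1 r)) r∈L)
      (λ (r , q<r , r∈L) →
         Equivalence.from (L-rounded x _) (_ , -1-mono q<r , r∈L))
  ; U-rounded   = λ q → mk⇔
      (λ q∈U → let r , r<q , r∈U = Equivalence.to (U-rounded x _) q∈U in
               r ℚ.+ 1ℚ , <-1⇒+1< r<q , ≡.subst (U x) (≡.sym (+1-1 r)) r∈U)
      (λ (r , r<q , r∈U) →
         Equivalence.from (U-rounded x _) (_ , -1-mono r<q , r∈U))
  ; disjoint    = λ q → disjoint x _
  ; located     = λ q<r → located x (-1-mono q<r)
  }

≤-refl : ∀ x → x ≤ x
≤-refl x q q∈L = q∈L

≤-trans : ∀ x y z → x ≤ y → y ≤ z → x ≤ z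
≤-trans x y z x≤y y≤z q q∈L = y≤z q (x≤y q q∈L)

------------------------------------------------------------------------
-- Boxes and cubes

record Interval : Set₁ where
  field
    lo hi : ℝ
    lo≤hi : lo ≤ hi

open Interval

⟦_⟧ᴵ : Interval → Pred ℝ 0ℓ
⟦ I ⟧ᴵ x = lo I ≤ x × x ≤ hi I

IsUnit : Pred Interval 0ℓ
IsUnit I = hi I ≃ lo I +1

Interval-setoid : Setoid (lsuc 0ℓ) 0ℓ
Interval-setoid = record
  { Carrier       = Interval
  ; _≈_           = λ I J → lo I ≃ lo J × hi I ≃ hi J
  ; isEquivalence = record
    { refl  = λ {I} → (≤-refl (lo I) , ≤-refl (lo I)) , (≤-refl (hi I) , ≤-refl (hi I))
    ; sym   = λ ((p , q) , (r , s)) → (q , p) , (s , r)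
    ; trans = λ {I} {J} {K} ((p , q) , (r , s)) ((p′ , q′) , (r′ , s′)) →
        (≤-trans (lo I) (lo J) (lo K) p p′ , ≤-trans (lo K) (lo J) (lo I) q′ q) ,
        (≤-trans (hi I) (hi J) (hi K) r r′ , ≤-trans (hi K) (hi J) (hi I) s′ s)
    }
  }

Box : ℕ → Set₁
Box k = Vector Interval k

Box-setoid : ℕ → Setoid (lsuc 0ℓ) 0ℓ
Box-setoid = VectorEquality.≋-setoid Interval-setoid

-- The product of the sides, as a set of points of ℝᵏ.
⟦_⟧ : ∀ {k} → Box k → Pred (Vector ℝ k) 0ℓ
⟦ B ⟧ x = ∀ i → x i ∈ ⟦ B i ⟧ᴵ

IsCube : ∀ {k} → Pred (Box k) 0ℓ
IsCube B = ∀ i → IsUnit (B i)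

------------------------------------------------------------------------
-- Finite simple graphs

-- The vertices form a setoid, so that quotients such as the vertex set of
-- the reduced power graph are available. Finiteness is the existence of a
-- (possibly repetitive) enumeration of the vertices up to _≈_.
record Graph v ℓ e : Set (lsuc (v ⊔ ℓ ⊔ e)) where
  field
    vertices    : Setoid v ℓ
    size        : ℕ
    enumeration : Surjection (≡.setoid (Fin size)) vertices
  open Setoid vertices public using (_≈_) renaming (Carrier to Vertex)
  field
    Adj         : Rel Vertex e
    Adj-resp-≈  : Adj Respects₂ _≈_
    Adj-sym     : Symmetric Adj
    Adj-irrefl  : Irreflexive _≈_ Adj

module _ (Γ : Graph v ℓ e) where
  open Graph Γ

  IsRepresentation : ∀ {k} → Pred (Func vertices (Box-setoid k)) _
  IsRepresentation f =
    ∀ u v → ¬ u ≈ v → Adj u v ⇔ ⟦ Func.to f u ⟧ ≬ ⟦ Func.to f v ⟧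

  HasBoxRep : Pred ℕ _
  HasBoxRep k = ∃ λ (f : Func vertices (Box-setoid k)) → IsRepresentation f

  HasCubeRep : Pred ℕ _
  HasCubeRep k = ∃ λ (f : Func vertices (Box-setoid k)) →
    (∀ u → IsCube (Func.to f u)) × IsRepresentation f

IsLeast : Pred ℕ a → Pred ℕ a
IsLeast P k = k ∈ P × (∀ j → j ∈ P → k ℕ.≤ j)

-- `IsBoxicity Γ k` says box(Γ) = k, and `IsCubicity Γ k` says cub(Γ) = k.
-- They are relations because computing the minimum would require deciding
-- representability; `¬¬∃boxicity` and `¬¬∃cubicity` below show that the
-- values exist classically. ℝ⁰ is a point and every 0-box is all of it, so
-- the complete graphs are exactly those with boxicity (cubicity) 0.
IsBoxicity : Graph v ℓ e → Pred ℕ _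
IsBoxicity Γ = IsLeast (HasBoxRep Γ)

IsCubicity : Graph v ℓ e → Pred ℕ _
IsCubicity Γ = IsLeast (HasCubeRep Γ)

------------------------------------------------------------------------
-- Power graphs of finite groups

-- A bijection, rather than a mere enumeration, so that equality of group
-- elements is decidable.
IsFinite : Setoid c ℓ → Set (c ⊔ ℓ)
IsFinite S = ∃ λ n → Inverse (≡.setoid (Fin n)) S

module _ (G : Group c ℓ) where
  open Group G
  open MonoidMult monoid using () renaming (_×_ to _·_)

  infixr 8 _^_ _^ᶻ_

  _^_ : Carrier → ℕ → Carrier
  x ^ n = n · x

  _^ᶻ_ : Carrier → ℤ → Carrier
  x ^ᶻ (+ n)      = x ^ n
  x ^ᶻ (-[1+ n ]) = (x ^ suc n) ⁻¹

  ⟨_⟩ : Carrier → Pred Carrier ℓ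
  ⟨ x ⟩ g = ∃ λ z → g ≈ x ^ᶻ z

  infix 4 _∼_

  _∼_ : Rel Carrier (c ⊔ ℓ)
  x ∼ y = ⟨ x ⟩ ≐ ⟨ y ⟩

  ∼-setoid : Setoid c (c ⊔ ℓ)
  ∼-setoid = record
    { Carrier       = Carrier
    ; _≈_           = _∼_
    ; isEquivalence = record
      { refl  = id , id
      ; sym   = λ (p , q) → q , p
      ; trans = λ (p , q) (p′ , q′) → (λ z → p′ (p z)) , (λ z → q (q′ z))
      }
    }

  IsPositivePowerOf : Rel Carrier ℓ
  IsPositivePowerOf x y = ∃ λ m → 0 ℕ.< m × x ≈ y ^ m

  PowAdj : Rel Carrier ℓ
  PowAdj x y = ¬ x ≈ y × (IsPositivePowerOf x y ⊎ IsPositivePowerOf y x)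

  RAdj : Rel Carrier (c ⊔ ℓ)
  RAdj x y = ¬ x ∼ y × PowAdj x y

module _ (G : Group c ℓ) (fin : IsFinite (Group.setoid G)) where
  open Group G
  open MonoidMult monoid using (×-congʳ; ×-assocˡ; ×-homo-+; ×-homo-1; ×-congˡ)
  open GroupProperties G using (inverseʳ-unique; ∙-cancelˡ)

  private
    infixr 8 _^′_
    _^′_ : Carrier → ℕ → Carrier
    _^′_ = _^_ G

    n     = proj₁ fin
    index = Inverse.from (proj₂ fin)

    enum : Surjection (≡.setoid (Fin n)) setoid
    enum = LeftInverse.surjection (Inverse.leftInverse (proj₂ fin))

  index-injective : ∀ {x y} → index x ≡ index y → x ≈ y
  index-injective {x} {y} eq = trans (sym (Inverse.inverseˡ (proj₂ fin) ≡.refl))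
    (Inverse.inverseˡ (proj₂ fin) eq)

  exponent : ∀ x → ∃ λ N → x ^′ suc N ≈ ε
  exponent x =
    let i , j , i<j , eq = Fin.pigeonhole {n = suc n} (ℕ.n<1+n n)
                             (λ i → index (x ^′ toℕ i))
        d , si+d≡j = ℕ.m≤n⇒∃[o]m+o≡n i<j
        j≡i+sd = ≡.trans (≡.sym si+d≡j) (≡.sym (ℕ.+-suc (toℕ i) d))
    in d , ∙-cancelˡ (x ^′ toℕ i) _ _
      (trans (sym (×-homo-+ x (toℕ i) (suc d)))
      (trans (×-congˡ (≡.sym j≡i+sd))
      (trans (sym (index-injective eq)) (sym (identityʳ _)))))


  ∈⟨⟩⇒positivePower : ∀ {g x} → g ∈ ⟨_⟩ G x → IsPositivePowerOf G g x
  ∈⟨⟩⇒positivePower {g} {x} (+ zero , g≈) =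
    let N , x^N≈ε = exponent x in suc N , s≤s z≤n , trans g≈ (sym x^N≈ε)
  ∈⟨⟩⇒positivePower (+ suc m , g≈) = suc m , s≤s z≤n , g≈
  ∈⟨⟩⇒positivePower {g} {x} (-[1+ m ] , g≈)
    with exponent (x ^′ suc m)
  ... | zero  , y≈ε = suc m , s≤s z≤n ,
    trans g≈ (sym (inverseʳ-unique _ _
      (trans (∙-congˡ (trans (sym (identityʳ _)) y≈ε))
             (trans (∙-congʳ (trans (sym (identityʳ _)) y≈ε)) (identityˡ ε)))))
  ... | suc N , y≈ε = suc N ℕ.* suc m , s≤s z≤n ,
    trans g≈ (trans (sym (inverseʳ-unique _ _ y≈ε)) (×-assocˡ x (suc N) (suc m)))

  ∈⟨self⟩ : ∀ x → x ∈ ⟨_⟩ G x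
  ∈⟨self⟩ x = + 1 , sym (×-homo-1 x)

  ∼⇒positivePower : ∀ {x y} → _∼_ G x y → IsPositivePowerOf G x y
  ∼⇒positivePower {x} (x⊆y , _) = ∈⟨⟩⇒positivePower (x⊆y (∈⟨self⟩ x))

  positivePower-trans : ∀ {x y z} → IsPositivePowerOf G x y →
                        IsPositivePowerOf G y z → IsPositivePowerOf G x z
  positivePower-trans {z = z} (suc m , _ , x≈) (suc k , _ , y≈) =
    suc m ℕ.* suc k , s≤s z≤n ,
    trans x≈ (trans (×-congʳ (suc m) y≈) (×-assocˡ z (suc m) (suc k)))

  ^ᶻ-congˡ : ∀ {x y} → x ≈ y → ∀ z → _^ᶻ_ G x z ≈ _^ᶻ_ G y z
  ^ᶻ-congˡ x≈y (+ m)      = ×-congʳ m x≈y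
  ^ᶻ-congˡ x≈y (-[1+ m ]) = ⁻¹-cong (×-congʳ (suc m) x≈y)

  ≈⇒∼ : ∀ {x y} → x ≈ y → _∼_ G x y
  ≈⇒∼ x≈y = (λ (z , g≈) → z , trans g≈ (^ᶻ-congˡ x≈y z))
          , (λ (z , g≈) → z , trans g≈ (^ᶻ-congˡ (sym x≈y) z))

  private module S = Setoid (∼-setoid G)

  PowAdj-sym : Symmetric (PowAdj G)
  PowAdj-sym (x≉y , p) = (λ y≈x → x≉y (sym y≈x)) , Sum.swap p

  PowAdj-respʳ : ∀ {x y z} → y ≈ z → PowAdj G x y → PowAdj G x z
  PowAdj-respʳ y≈z (x≉y , p) =
    (λ x≈z → x≉y (trans x≈z (sym y≈z))) ,
    Sum.map (λ (m , m>0 , q) → m , m>0 , trans q (×-congʳ m y≈z))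
            (λ (m , m>0 , q) → m , m>0 , trans (sym y≈z) q) p

  RAdj-sym : Symmetric (RAdj G)
  RAdj-sym (x≁y , p) = (λ y∼x → x≁y (S.sym y∼x)) , PowAdj-sym p

  RAdj-respʳ : ∀ {x y z} → _∼_ G y z → RAdj G x y → RAdj G x z
  RAdj-respʳ {x} {y} {z} y∼z (x≁y , _ , p) =
    x≁z , (λ x≈z → x≁z (≈⇒∼ x≈z)) ,
    Sum.map (λ q → positivePower-trans q (∼⇒positivePower y∼z))
            (λ q → positivePower-trans (∼⇒positivePower (S.sym y∼z)) q) p
    where
    x≁z : ¬ _∼_ G x z
    x≁z x∼z = x≁y (S.trans x∼z (S.sym y∼z))

  Pow : Graph c ℓ ℓ
  Pow = record
    { vertices    = setoid
    ; size        = n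
    ; enumeration = enum
    ; Adj         = PowAdj G
    ; Adj-resp-≈  = PowAdj-respʳ
                  , (λ y≈z p → PowAdj-sym (PowAdj-respʳ y≈z (PowAdj-sym p)))
    ; Adj-sym     = PowAdj-sym
    ; Adj-irrefl  = λ x≈y (x≉y , _) → x≉y x≈y
    }

  R : Graph c (c ⊔ ℓ) (c ⊔ ℓ)
  R = record
    { vertices    = ∼-setoid G
    ; size        = n
    ; enumeration = record
      { to         = Surjection.to enum
      ; cong       = λ eq → ≈⇒∼ (Surjection.cong enum eq)
      ; surjective = λ y → let i , h = Surjection.surjective enum y in
                           i , (λ eq → ≈⇒∼ (h eq))
      }
    ; Adj         = RAdj G
    ; Adj-resp-≈  = RAdj-respʳ
                  , (λ y∼z p → RAdj-sym (RAdj-respʳ y∼z (RAdj-sym p)))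
    ; Adj-sym     = RAdj-sym
    ; Adj-irrefl  = λ x∼y (x≁y , _) → x≁y x∼y
    }

------------------------------------------------------------------------
-- Every finite graph has a boxicity and a cubicity (classically)

private
  0ℝ : ℝ
  0ℝ = record
    { L           = ℚ._< 0ℚ
    ; U           = 0ℚ ℚ.<_
    ; L-inhabited = ℚ.- 1ℚ , ℚ.negative⁻¹ (ℚ.- 1ℚ)
    ; U-inhabited = 1ℚ , ℚ.positive⁻¹ 1ℚ
    ; L-rounded   = λ q → mk⇔
        (λ q<0 → let r , q<r , r<0 = ℚ.<-dense q<0 in r , q<r , r<0)
        (λ (r , q<r , r<0) → ℚ.<-trans q<r r<0)
    ; U-rounded   = λ q → mk⇔
        (λ 0<q → let r , 0<r , r<q = ℚ.<-dense 0<q in r , r<q , 0<r)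
        (λ (r , r<q , 0<r) → ℚ.<-trans 0<r r<q)
    ; disjoint    = λ q → ℚ.<-asym
    ; located     = located-0
    }
    where
    located-0 : ∀ {q r} → q ℚ.< r → q ℚ.< 0ℚ ⊎ 0ℚ ℚ.< r
    located-0 {q} q<r with q ℚ.<? 0ℚ
    ... | yes q<0 = inj₁ q<0
    ... | no  q≮0 = inj₂ (ℚ.≤-<-trans (ℚ.≮⇒≥ q≮0) q<r)

  q-1<q : ∀ q → q ℚ.- 1ℚ ℚ.< q
  q-1<q q = ≡.subst (q ℚ.- 1ℚ ℚ.<_) (ℚ.+-identityʳ q)
              (ℚ.+-monoʳ-< q (ℚ.negative⁻¹ (ℚ.- 1ℚ)))

  x≤x+1 : ∀ x → x ≤ x +1
  x≤x+1 x q q∈L = Equivalence.from (L-rounded x _) (q , q-1<q q , q∈L)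

  unit : ℝ → Interval
  unit x = record { lo = x ; hi = x +1 ; lo≤hi = x≤x+1 x }

  1ℝ 2ℝ : ℝ
  1ℝ = 0ℝ +1
  2ℝ = 1ℝ +1

  2≰1 : ¬ 2ℝ ≤ 1ℝ
  2≰1 2≤1 = ℚ.<-irrefl ≡.refl (2≤1 1ℚ (ℚ.negative⁻¹ (ℚ.- 1ℚ)))

  -- The i-th side of the cube of v is [0,1] if v is the i-th vertex,
  -- [1,2] if v is adjacent to it, and [2,3] otherwise.
  side : ∀ {A : Set a} {B : Set ℓ} → Dec A → Dec B → ℝ
  side (yes _) _       = 0ℝ
  side (no _)  (yes _) = 1ℝ
  side (no _)  (no _)  = 2ℝ

  side-cong : ∀ {A A′ : Set a} {B B′ : Set ℓ} (p : Dec A) (p′ : Dec A′)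
              (q : Dec B) (q′ : Dec B′) → A ⇔ A′ → B ⇔ B′ →
              side p q ≡ side p′ q′
  side-cong (yes _) (yes _) _ _ _ _ = ≡.refl
  side-cong (yes x) (no ¬x) _ _ A⇔ _ = contradiction (Equivalence.to A⇔ x) ¬x
  side-cong (no ¬x) (yes x) _ _ A⇔ _ = contradiction (Equivalence.from A⇔ x) ¬x
  side-cong (no _) (no _) (yes _) (yes _) _ _ = ≡.refl
  side-cong (no _) (no _) (yes x) (no ¬x) _ B⇔ = contradiction (Equivalence.to B⇔ x) ¬x
  side-cong (no _) (no _) (no ¬x) (yes x) _ B⇔ = contradiction (Equivalence.from B⇔ x) ¬x
  side-cong (no _) (no _) (no _) (no _) _ _ = ≡.refl

  ¬¬-sequence : ∀ {n} {P : Pred (Fin n) a} →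
                (∀ i → ¬ ¬ P i) → ¬ ¬ (∀ i → P i)
  ¬¬-sequence = Fin.sequence (RawMonad.rawApplicative ¬¬-Monad)
    where open import Effect.Monad using (module RawMonad)

  ¬¬least : (P : Pred ℕ a) → ∀ m → m ∈ P → ¬ ¬ ∃ (IsLeast P)
  ¬¬least {a} P m m∈P none = none-below (suc m) m (ℕ.n<1+n m) m∈P
    where
    none-below : ∀ k j → j ℕ.< k → j ∉ P
    none-below (suc k) j (s≤s j≤k) j∈P = none (j , j∈P , λ i i∈P →
      ℕ.≮⇒≥ (λ i<j → none-below k i (ℕ.<-≤-trans i<j j≤k) i∈P))

module _ (Γ : Graph v ℓ e) where
  open Graph Γ
  private
    module V = Setoid vertices
    vertex = Surjection.to enumeration

    locate : ∀ u → ∃ λ i → vertex i ≈ u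
    locate u = let i , h = Surjection.surjective enumeration u in i , h ≡.refl

    respˡ : ∀ {u v w} → u ≈ v → Adj u w → Adj v w
    respˡ = proj₂ Adj-resp-≈

    respʳ : ∀ {u v w} → u ≈ v → Adj w u → Adj w v
    respʳ = proj₁ Adj-resp-≈

    module Construction (eq? : ∀ i j → Dec (vertex i ≈ vertex j))
                        (adj? : ∀ i j → Dec (Adj (vertex i) (vertex j))) where

      is? : ∀ i u → Dec (vertex i ≈ u)
      is? i u = let j , e = locate u in
        map′ (λ p → V.trans p e) (λ p → V.trans p (V.sym e)) (eq? i j)

      adjacent? : ∀ i u → Dec (Adj (vertex i) u)
      adjacent? i u = let j , e = locate u in
        map′ (respʳ e) (respʳ (V.sym e)) (adj? i j)

      start : Vertex → Fin size → ℝ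
      start u i = side (is? i u) (adjacent? i u)

      start-cong : ∀ {u v} → u ≈ v → ∀ i → start u i ≡ start v i
      start-cong {u} {v} u≈v i =
        side-cong (is? i u) (is? i v) (adjacent? i u) (adjacent? i v)
          (mk⇔ (λ p → V.trans p u≈v) (λ p → V.trans p (V.sym u≈v)))
          (mk⇔ (respʳ u≈v) (respʳ (V.sym u≈v)))

      cube : Func vertices (Box-setoid size)
      cube = record
        { to   = λ u i → unit (start u i)
        ; cong = λ {u} {v} u≈v i → ≡.subst
                   (λ s → Setoid._≈_ Interval-setoid (unit (start u i)) (unit s))
                   (start-cong u≈v i)
                   (Setoid.refl Interval-setoid {x = unit (start u i)})
        }

      meet : ∀ u v → Adj u v → ∀ i → ⟦ unit (start u i) ⟧ᴵ ≬ ⟦ unit (start v i) ⟧ᴵ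
      meet u v uv i with is? i u | is? i v | adjacent? i u | adjacent? i v
      ... | yes _  | yes _  | _      | _      = 0ℝ , (≤-refl 0ℝ , x≤x+1 0ℝ) , (≤-refl 0ℝ , x≤x+1 0ℝ)
      ... | yes _  | no _   | _      | yes _  = 1ℝ , (x≤x+1 0ℝ , ≤-refl 1ℝ) , (≤-refl 1ℝ , x≤x+1 1ℝ)
      ... | yes iu | no _   | _      | no ¬iv = contradiction (respˡ (V.sym iu) uv) ¬iv
      ... | no _   | yes _  | yes _  | _      = 1ℝ , (≤-refl 1ℝ , x≤x+1 1ℝ) , (x≤x+1 0ℝ , ≤-refl 1ℝ)
      ... | no _   | yes iv | no ¬iu | _      = contradiction (respˡ (V.sym iv) (Adj-sym uv)) ¬iu
      ... | no _   | no _   | yes _  | yes _  = 1ℝ , (≤-refl 1ℝ , x≤x+1 1ℝ) , (≤-refl 1ℝ , x≤x+1 1ℝ)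
      ... | no _   | no _   | yes _  | no _   = 2ℝ , (x≤x+1 1ℝ , ≤-refl 2ℝ) , (≤-refl 2ℝ , x≤x+1 2ℝ)
      ... | no _   | no _   | no _   | yes _  = 2ℝ , (≤-refl 2ℝ , x≤x+1 2ℝ) , (x≤x+1 1ℝ , ≤-refl 2ℝ)
      ... | no _   | no _   | no _   | no _   = 2ℝ , (≤-refl 2ℝ , x≤x+1 2ℝ) , (≤-refl 2ℝ , x≤x+1 2ℝ)

      separated : ∀ i u v → ¬ u ≈ v → vertex i ≈ u →
                  ⟦ unit (start u i) ⟧ᴵ ≬ ⟦ unit (start v i) ⟧ᴵ → Adj u v
      separated i u v u≉v iu (x , (_ , x≤) , (≤x , _))
        with is? i u | is? i v | adjacent? i v
      ... | no ¬iu | _      | _      = contradiction iu ¬iu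
      ... | yes _  | yes iv | _      = contradiction (V.trans (V.sym iu) iv) u≉v
      ... | yes _  | no _   | yes iv = respˡ iu iv
      ... | yes _  | no _   | no _   = contradiction (≤-trans 2ℝ x 1ℝ ≤x x≤) 2≰1

      cubeRep : HasCubeRep Γ size
      cubeRep = cube , (λ u i → let h = hi (unit (start u i)) in ≤-refl h , ≤-refl h) ,
        λ u v u≉v → mk⇔
        (λ uv → (λ i → proj₁ (meet u v uv i)) ,
                (λ i → proj₁ (proj₂ (meet u v uv i))) ,
                (λ i → proj₂ (proj₂ (meet u v uv i))))
        (λ (x , x∈u , x∈v) → let i , iu = locate u in
          separated i u v u≉v iu (x i , x∈u i , x∈v i))

    ¬¬cubeRep : ¬ ¬ HasCubeRep Γ size
    ¬¬cubeRep none =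
      ¬¬-sequence (λ i → ¬¬-sequence (λ j → ¬¬-excluded-middle)) λ eq? →
      ¬¬-sequence (λ i → ¬¬-sequence (λ j → ¬¬-excluded-middle)) λ adj? →
      none (Construction.cubeRep eq? adj?)

  ¬¬∃boxicity : ¬ ¬ ∃ (IsBoxicity Γ)
  ¬¬∃boxicity none = ¬¬cubeRep λ (f , _ , rep) →
    ¬¬least (HasBoxRep Γ) size (f , rep) none

  ¬¬∃cubicity : ¬ ¬ ∃ (IsCubicity Γ)
  ¬¬∃cubicity none = ¬¬cubeRep λ rep → ¬¬least (HasCubeRep Γ) size rep none

{-# OPTIONS --safe #-}

-- A representation of R(G), read on elements of G, represents Pow(G), because two generators of the same cyclic subgroup are positive
-- powers of one another and get the same box, which is nonempty. Conversely,
-- restricting a representation of Pow(G) to one generator per cyclic subgroup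
-- represents R(G); the chosen generator is the first one in the enumeration of
-- G, which exists since membership in a cyclic subgroup is decidable.
-- Both constructions preserve the dimension and the cube property.
module Submission where

open import Defs
open import Algebra.Bundles using (Group)
open import Data.Product.Base using (∃; _×_; _,_; proj₁; proj₂)
open import Function.Bundles using (_⇔_; mk⇔; Equivalence; Func; Inverse)
import Algebra.Properties.Monoid.Mult as MonoidMult
open import Data.Fin.Base as Fin using (Fin; zero; suc; toℕ; fromℕ<)
import Data.Fin.Properties as Fin
open import Data.Integer.Base using (+_)
open import Data.Nat.Base as ℕ using (ℕ; zero; suc; z≤n; s≤s)
open import Data.Nat.DivMod using (_/_; _%_; m≡m%n+[m/n]*n; m%n<n)
open import Data.Sum.Base using (inj₁)
open import Function.Base using (_∘_)
open import Function.Properties.Equivalence using () renaming (sym to ⇔-sym)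
open import Level using (Level)
open import Relation.Binary.Bundles using (Setoid)
open import Relation.Binary.Definitions using (Decidable)
open import Relation.Binary.PropositionalEquality as ≡ using (_≡_)
open import Relation.Nullary using (¬_; Dec; yes; no; contradiction)
open import Relation.Nullary.Decidable using (map′; _×-dec_)
import Relation.Unary as Unary
open import Relation.Unary using (Pred; _∈_; _≬_)

private
  variable
    a b : Level

-- Boxicity and cubicity are relations here, so comparing them for two graphs reduces to showing
-- that the same dimensions admit representations.
IsLeast-resp-⇔ : {P : Pred ℕ a} {Q : Pred ℕ b} → (∀ k → P k ⇔ Q k) →
                 ∀ k → IsLeast P k ⇔ IsLeast Q k
IsLeast-resp-⇔ P⇔Q k = mk⇔ (transfer P⇔Q) (transfer (⇔-sym ∘ P⇔Q))
  where
  transfer : ∀ {a b} {P : Pred ℕ a} {Q : Pred ℕ b} → (∀ k → P k ⇔ Q k) →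
             IsLeast P k → IsLeast Q k
  transfer P⇔Q (p , min) = Equivalence.to (P⇔Q k) p ,
    λ j q → min j (Equivalence.from (P⇔Q j) q)

least : ∀ {n} {P : Pred (Fin n) a} → Unary.Decidable P → ∃ P →
        ∃ λ i → P i × (∀ j → P j → i Fin.≤ j)
least {n = suc n} P? (i , pᵢ) with P? zero
... | yes p₀ = zero , p₀ , λ _ _ → z≤n
least P? (zero  , p₀) | no ¬p₀ = contradiction p₀ ¬p₀
least P? (suc i , pᵢ) | no ¬p₀ =
  let j , pⱼ , min = least (P? ∘ suc) (i , pᵢ) in
  suc j , pⱼ , λ where
    zero    p₀ → contradiction p₀ ¬p₀
    (suc k) pₖ → s≤s (min k pₖ)

-- The lower corner of `B` is a common point: `lo≤hi` puts it in `B`, and the equality of endpoints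
-- carries it into `C`.
boxes-meet : ∀ {k} {B C : Box k} → Setoid._≈_ (Box-setoid k) B C → ⟦ B ⟧ ≬ ⟦ C ⟧
boxes-meet {B = B} B≈C = (λ i → lo (B i)) ,
  (λ i → ≤-refl (lo (B i)) , lo≤hi (B i)) ,
  (λ i → proj₂ (proj₁ (B≈C i)) , λ q → proj₁ (proj₂ (B≈C i)) q ∘ lo≤hi (B i) q)
  where open Interval

module _ {c ℓ} (G : Group c ℓ) (fin : IsFinite (Group.setoid G)) where
  open Group G
  open MonoidMult monoid using (×-congʳ; ×-congˡ; ×-assocˡ; ×-homo-+)
    renaming (_×_ to _·_)

  private
    infix 4 _∼ᴳ_
    _∼ᴳ_ : Carrier → Carrier → Set _
    _∼ᴳ_ = _∼_ G
    module ∼ = Setoid (∼-setoid G)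

    vertex : Fin (proj₁ fin) → Carrier
    vertex = Inverse.to (proj₂ fin)

    index : Carrier → Fin (proj₁ fin)
    index = Inverse.from (proj₂ fin)

  _≟_ : Decidable _≈_
  x ≟ y = map′ (index-injective G fin) (Inverse.from-cong (proj₂ fin))
               (index x Fin.≟ index y)

  ·-ε : ∀ m → m · ε ≈ ε
  ·-ε zero  = refl
  ·-ε (suc m) = trans (identityˡ _) (·-ε m)

  ·-mod : ∀ {x} N → suc N · x ≈ ε → ∀ m → m · x ≈ (m % suc N) · x
  ·-mod {x} N Nx≈ε m =
    trans (×-congˡ (m≡m%n+[m/n]*n m (suc N)))
    (trans (×-homo-+ x (m % suc N) _)
    (trans (∙-congˡ (trans (sym (×-assocˡ x (m / suc N) (suc N)))
                    (trans (×-congʳ (m / suc N) Nx≈ε) (·-ε (m / suc N)))))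
           (identityʳ _)))

  -- Since `suc N · x ≈ ε`, exponents matter only modulo `suc N`; membership becomes a finite search
  -- over the remainders.
  _∈⟨⟩?_ : ∀ g x → Dec (g ∈ ⟨_⟩ G x)
  g ∈⟨⟩? x with exponent G fin x
  ... | N , Nx≈ε = map′ (λ (i , g≈) → + toℕ i , g≈)
    (λ g∈ → let m , _ , g≈ = ∈⟨⟩⇒positivePower G fin g∈
                r<N = m%n<n m (suc N) in
      fromℕ< r<N ,
      trans g≈ (trans (·-mod N Nx≈ε m) (×-congˡ (≡.sym (Fin.toℕ-fromℕ< r<N)))))
    (Fin.any? λ i → g ≟ (toℕ i · x))

  -- Finiteness turns both memberships into positive powers, which compose without a case split on
  -- signs.
  ∈⟨⟩-⊆ : ∀ {x y} → x ∈ ⟨_⟩ G y → ⟨_⟩ G x Unary.⊆ ⟨_⟩ G y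
  ∈⟨⟩-⊆ x∈ g∈ =
    let m , _ , g≈ = positivePower-trans G fin (∈⟨⟩⇒positivePower G fin g∈)
                                               (∈⟨⟩⇒positivePower G fin x∈)
    in + m , g≈

  _∼?_ : Decidable _∼ᴳ_
  x ∼? y = map′ (λ (x∈ , y∈) → ∈⟨⟩-⊆ x∈ , ∈⟨⟩-⊆ y∈)
                (λ (x⊆y , y⊆x) → x⊆y (∈⟨self⟩ G fin x) , y⊆x (∈⟨self⟩ G fin y))
                ((x ∈⟨⟩? y) ×-dec (y ∈⟨⟩? x))

  private
    leastIndex : ∀ x → ∃ λ i → vertex i ∼ᴳ x × (∀ j → vertex j ∼ᴳ x → i Fin.≤ j)
    leastIndex x = least (λ i → vertex i ∼? x)
      (index x , ≈⇒∼ G fin (Inverse.inverseˡ (proj₂ fin) ≡.refl))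

  representative : Carrier → Carrier
  representative x = vertex (proj₁ (leastIndex x))

  representative-∼ : ∀ x → representative x ∼ᴳ x
  representative-∼ x = proj₁ (proj₂ (leastIndex x))

  -- Each minimal index also lies in the other's class, so antisymmetry identifies them. Mere `∼`
  -- would not suffice: a representation of Pow(G) respects only `≈`.
  representative-cong : ∀ {x y} → x ∼ᴳ y → representative x ≡ representative y
  representative-cong {x} {y} x∼y =
    let i , i∼x , i-min = leastIndex x
        j , j∼y , j-min = leastIndex y
    in ≡.cong vertex (Fin.≤-antisym (i-min j (∼.trans j∼y (∼.sym x∼y)))
                                    (j-min i (∼.trans i∼x x∼y)))

  representative-≁ : ∀ {x y} → ¬ x ∼ᴳ y → ¬ representative x ∼ᴳ representative y
  representative-≁ {x} {y} x≁y r∼s =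
    x≁y (∼.trans (∼.sym (representative-∼ x)) (∼.trans r∼s (representative-∼ y)))

  module _ {k : ℕ} where

    pull : Func (∼-setoid G) (Box-setoid k) → Func setoid (Box-setoid k)
    pull f = record { to = Func.to f ; cong = Func.cong f ∘ ≈⇒∼ G fin }

    pull-represents : ∀ f → IsRepresentation (R G fin) f →
                      IsRepresentation (Pow G fin) (pull f)
    pull-represents f rep u v u≉v with u ∼? v
    -- Here `rep` says nothing, but both sides hold: the boxes are equal and nonempty, and the
    -- generators are positive powers of each other.
    ... | yes u∼v = mk⇔ (λ _ → boxes-meet {B = Func.to f u} {Func.to f v} (Func.cong f u∼v))
                        (λ _ → u≉v , inj₁ (∼⇒positivePower G fin u∼v))
    ... | no  u≁v = mk⇔ (λ uv → Equivalence.to (rep u v u≁v) (u≁v , uv))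
                        (λ meet → proj₂ (Equivalence.from (rep u v u≁v) meet))

    restrict : Func setoid (Box-setoid k) → Func (∼-setoid G) (Box-setoid k)
    restrict f = record
      { to   = Func.to f ∘ representative
      ; cong = λ x∼y → Func.cong f (reflexive (representative-cong x∼y))
      }

    -- Adjacency in R(G) is invariant under `∼`, so it can be tested at the representatives, where
    -- it amounts to adjacency in Pow(G).
    restrict-represents : ∀ f → IsRepresentation (Pow G fin) f →
                          IsRepresentation (R G fin) (restrict f)
    restrict-represents f rep u v u≁v = mk⇔
      (λ uv → Equivalence.to repᵤᵥ (proj₂ (resp₂ (∼.sym u′∼u) (∼.sym v′∼v) uv)))
      (λ meet → resp₂ u′∼u v′∼v (u′≁v′ , Equivalence.from repᵤᵥ meet))
      where
      u′∼u  = representative-∼ u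
      v′∼v  = representative-∼ v
      u′≁v′ = representative-≁ u≁v
      repᵤᵥ = rep (representative u) (representative v) (u′≁v′ ∘ ≈⇒∼ G fin)

      resp₂ : ∀ {x x′ y y′} → x ∼ᴳ x′ → y ∼ᴳ y′ → RAdj G x y → RAdj G x′ y′
      resp₂ x∼ y∼ = proj₂ (Graph.Adj-resp-≈ (R G fin)) x∼ ∘
                    proj₁ (Graph.Adj-resp-≈ (R G fin)) y∼

  boxRep⇔ : ∀ k → HasBoxRep (R G fin) k ⇔ HasBoxRep (Pow G fin) k
  boxRep⇔ k = mk⇔
    (λ (f , rep) → pull f , pull-represents f rep)
    (λ (f , rep) → restrict f , restrict-represents f rep)

  -- Being a cube is a condition on each box separately, and both constructions only reuse boxes of
  -- `f`.
  cubeRep⇔ : ∀ k → HasCubeRep (R G fin) k ⇔ HasCubeRep (Pow G fin) k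
  cubeRep⇔ k = mk⇔
    (λ (f , cube , rep) → pull f , cube , pull-represents f rep)
    (λ (f , cube , rep) →
       restrict f , cube ∘ representative , restrict-represents f rep)

mainTheorem5 : ∀ {c ℓ} (G : Group c ℓ) (fin : IsFinite (Group.setoid G)) →
    (∀ k → IsBoxicity (R G fin) k ⇔ IsBoxicity (Pow G fin) k) ×
    (∀ k → IsCubicity (R G fin) k ⇔ IsCubicity (Pow G fin) k)
mainTheorem5 G fin = IsLeast-resp-⇔ (boxRep⇔ G fin) , IsLeast-resp-⇔ (cubeRep⇔ G fin)
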